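{- Let $k\ge 1$ be an integer and let $G$ be a graph of order $n$. Then $$L_k(G)+L_k(\overline{G})\leq \begin{cases} 2n & \text{if } k\geq \max\{\Delta(G),\Delta(\overline{G})\}+1,\\ n+2k-2 & \text{if } k\leq \min\{\Delta(G),\Delta(\overline{G})\},\\ 2n-1 & \text{otherwise.}\end{cases}$$ Moreover, the upper bounds are tight: for each of the three cases there exist $k$ and $G$ satisfying the condition of that case for which equality holds in the corresponding bound.
   Context: All graphs are finite, undirected, simple and nontrivial (at least two vertices). $\overline{G}$ is the complement of $G$, $\Delta(G)$ the maximum degree, and $N[v]=\{v\}\cup N(v)$ the closed neighbourhood of $v$. For an integer $k\ge 1$, a set $B\subseteq V(G)$ is a $k$-limited packing if $|N[v]\cap B|\le k$ for every vertex $v$ of $G$; $L_k(G)$ is the maximum cardinality of a $k$-limited packing in $G$. -}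

module Defs where

open import Data.Fin using (Fin)
open import Data.Fin.Properties using (_≟_; all?)
open import Data.Fin.Subset using (Subset; inside; outside; ∣_∣; ⁅_⁆; _∩_; _∪_; ⊥)
open import Data.Fin.Subset.Properties using (∣⊥∣≡0; ∩-zeroʳ)
open import Data.List using (List; []; _∷_; _++_; map; filter; allFin)
open import Data.List.Extrema.Nat using (max; xs≤max; argmax-sel)
open import Data.List.Membership.Propositional using (_∈_)
open import Data.List.Membership.Propositional.Properties
  using (∈-map⁺; ∈-map⁻; ∈-++⁺ˡ; ∈-++⁺ʳ; ∈-filter⁺; ∈-filter⁻)
open import Data.List.Relation.Unary.All using (lookup)
open import Data.List.Relation.Unary.Any using (here)
open import Data.Nat using (ℕ; zero; suc; _+_; _≤_; _≥_; _⊔_; _⊓_; _≤?_; z≤n)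
open import Data.Product using (_×_; _,_; proj₂; ∃)
open import Data.Sum using (inj₁; inj₂)
open import Data.Vec as Vec using (tabulate)
open import Level using (0ℓ)
open import Relation.Binary using (Rel; Decidable; Symmetric; Irreflexive)
open import Relation.Binary.PropositionalEquality
  using (_≡_; _≢_; refl; sym; trans; cong; subst)
open import Relation.Nullary using (¬_; Dec; does; ¬?; _×-dec_)

-- Finite simple graphs of order n, with vertex set Fin n.  Adjacency is
-- decidable because the graphs are finite combinatorial objects: degrees and
-- packing numbers are then computed natural numbers.
record Graph (n : ℕ) : Set₁ where
  field
    _~_      : Rel (Fin n) 0ℓ
    _~?_     : Decidable _~_
    ~-sym    : Symmetric _~_
    ~-irrefl : Irreflexive _≡_ _~_

open Graph

complement : ∀ {n} → Graph n → Graph n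
complement G ._~_ u v = u ≢ v × ¬ (_~_ G u v)
complement G ._~?_ u v = ¬? (u ≟ v) ×-dec ¬? (_~?_ G u v)
complement G .~-sym (u≢v , u≁v) = (λ v≡u → u≢v (sym v≡u)) , (λ v~u → u≁v (~-sym G v~u))
complement G .~-irrefl u≡v (u≢v , _) = u≢v u≡v

N : ∀ {n} → Graph n → Fin n → Subset n
N G v = tabulate (λ u → does (_~?_ G v u))

N[_] : ∀ {n} → Graph n → Fin n → Subset n
N[ G ] v = ⁅ v ⁆ ∪ N G v

degree : ∀ {n} → Graph n → Fin n → ℕ
degree G v = ∣ N G v ∣

Δ : ∀ {n} → Graph n → ℕ
Δ {n} G = max 0 (map (degree G) (allFin n))

IsLimitedPacking : ∀ {n} → ℕ → Graph n → Subset n → Set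
IsLimitedPacking k G B = ∀ v → ∣ N[ G ] v ∩ B ∣ ≤ k

isLimitedPacking? : ∀ {n} k (G : Graph n) (B : Subset n) → Dec (IsLimitedPacking k G B)
isLimitedPacking? k G B = all? (λ v → ∣ N[ G ] v ∩ B ∣ ≤? k)

subsets : ∀ n → List (Subset n)
subsets zero    = Vec.[] ∷ []
subsets (suc n) = map (inside Vec.∷_) (subsets n) ++ map (outside Vec.∷_) (subsets n)

packings : ∀ {n} → ℕ → Graph n → List (Subset n)
packings {n} k G = filter (isLimitedPacking? k G) (subsets n)

-- The default value 0 is harmless: the empty set is always a k-limited
-- packing (see L-attained and L-upper below).
L : ∀ {n} → ℕ → Graph n → ℕ
L k G = max 0 (map ∣_∣ (packings k G))

∈-subsets : ∀ {n} (B : Subset n) → B ∈ subsets n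
∈-subsets Vec.[] = here refl
∈-subsets (inside Vec.∷ B) = ∈-++⁺ˡ (∈-map⁺ _ (∈-subsets B))
∈-subsets {suc n} (outside Vec.∷ B) =
  ∈-++⁺ʳ (map (inside Vec.∷_) (subsets n)) (∈-map⁺ _ (∈-subsets B))

L-upper : ∀ {n} k (G : Graph n) {B} → IsLimitedPacking k G B → ∣ B ∣ ≤ L k G
L-upper k G {B} p =
  lookup (xs≤max 0 (map ∣_∣ (packings k G)))
         (∈-map⁺ ∣_∣ (∈-filter⁺ (isLimitedPacking? k G) (∈-subsets B) p))

L-attained : ∀ {n} k (G : Graph n) → ∃ λ B → IsLimitedPacking k G B × ∣ B ∣ ≡ L k G
L-attained {n} k G with argmax-sel (λ x → x) 0 (map ∣_∣ (packings k G))
... | inj₁ L≡0 = ⊥ , ⊥-packing , trans (∣⊥∣≡0 n) (sym L≡0)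
  where
  ⊥-packing : IsLimitedPacking k G ⊥
  ⊥-packing v = subst (_≤ k) (sym (trans (cong ∣_∣ (∩-zeroʳ (N[ G ] v))) (∣⊥∣≡0 n))) z≤n
... | inj₂ L∈ with ∈-map⁻ ∣_∣ L∈
...   | B , B∈ , L≡ = B , proj₂ (∈-filter⁻ (isLimitedPacking? k G) {xs = subsets n} B∈) , sym L≡

LargeLimit : ∀ {n} → ℕ → Graph n → Set
LargeLimit k G = k ≥ (Δ G ⊔ Δ (complement G)) + 1

SmallLimit : ∀ {n} → ℕ → Graph n → Set
SmallLimit k G = k ≤ Δ G ⊓ Δ (complement G)

MiddleLimit : ∀ {n} → ℕ → Graph n → Set
MiddleLimit k G = ¬ LargeLimit k G × ¬ SmallLimit k G

{-# OPTIONS --safe #-}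
module Submission where

-- Fix k-limited packings B of G and C of its complement. Since N[ G ] v and
-- N[ complement G ] v cover V and share only v, the parts of B and C outside
-- these neighbourhoods are disjoint and miss v, so ∣B∣ + ∣C∣ ≤ 2k + (n − 1).
-- In the small case neither B nor C is all of V; vertices u ∉ B and w ∉ C
-- then yield a centre v for which a second vertex is missed as well.
-- Outside the large case B and C cannot both be all of V.

open import Defs
open import Data.Bool using (true; false)
open import Data.Fin using (Fin; zero; suc; toℕ)
open import Data.Fin.Properties using (¬∀⟶∃¬) renaming (_≟_ to _≟ᶠ_)
open import Data.Fin.Subset using (Subset; ∣_∣; ∁; _∩_; _-_; _∈_; _∉_; ⊤)
open import Data.Fin.Subset.Properties
open import Data.List.Extrema.Nat using (max<v⁺)
open import Data.List.Relation.Unary.All.Properties using (map⁺; tabulate⁺)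
open import Data.Nat
  using (ℕ; zero; suc; _+_; _*_; _∸_; _≤_; _<_; _≟_; _%_; z≤n; s≤s)
open import Data.Nat.Properties hiding (_≟_)
open import Data.Nat.Tactic.RingSolver using (solve-∀)
open import Data.Product using (_×_; _,_; proj₁; proj₂; ∃; ∃-syntax; Σ-syntax)
open import Data.Sum using (inj₁; inj₂)
open import Data.Vec using ([]; _∷_)
open import Data.Vec.Properties using (lookup∘tabulate; lookup⇒[]=; []=⇒lookup)
open import Function using (_∘_)
open import Relation.Binary.PropositionalEquality
open import Relation.Nullary using (¬_; yes; no; ¬?; does)
open import Relation.Nullary.Decidable using (dec-true)

private
  variable
    k n : ℕ
    u v w : Fin n
    B C : Subset n

∣p∣≡∣q∩p∣+∣∁q∩p∣ : ∀ (p q : Subset n) → ∣ p ∣ ≡ ∣ q ∩ p ∣ + ∣ ∁ q ∩ p ∣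
∣p∣≡∣q∩p∣+∣∁q∩p∣ []          []          = refl
∣p∣≡∣q∩p∣+∣∁q∩p∣ (false ∷ p) (false ∷ q) = ∣p∣≡∣q∩p∣+∣∁q∩p∣ p q
∣p∣≡∣q∩p∣+∣∁q∩p∣ (false ∷ p) (true  ∷ q) = ∣p∣≡∣q∩p∣+∣∁q∩p∣ p q
∣p∣≡∣q∩p∣+∣∁q∩p∣ (true  ∷ p) (true  ∷ q) = cong suc (∣p∣≡∣q∩p∣+∣∁q∩p∣ p q)
∣p∣≡∣q∩p∣+∣∁q∩p∣ (true  ∷ p) (false ∷ q) =
  trans (cong suc (∣p∣≡∣q∩p∣+∣∁q∩p∣ p q)) (sym (+-suc ∣ q ∩ p ∣ ∣ ∁ q ∩ p ∣))

-- Disjointness and the two missed vertices put `q` inside `∁ p - v - w`. Both deletions really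
-- lower the cardinality, because `v` and `w` are distinct elements of `∁ p`.
disjoint-missing-two : {p q : Subset n} {v w : Fin n} → (∀ {x} → x ∈ p → x ∉ q) → v ≢ w →
  v ∉ p → v ∉ q → w ∉ p → w ∉ q → ∣ p ∣ + ∣ q ∣ + 2 ≤ n
disjoint-missing-two {n} {p} {q} {v} {w} disjoint v≢w v∉p v∉q w∉p w∉q = begin
  ∣ p ∣ + ∣ q ∣ + 2      ≡⟨ +-assoc ∣ p ∣ ∣ q ∣ 2 ⟩
  ∣ p ∣ + (∣ q ∣ + 2)    ≡⟨ cong (∣ p ∣ +_) (+-comm ∣ q ∣ 2) ⟩
  ∣ p ∣ + (2 + ∣ q ∣)    ≤⟨ +-monoʳ-≤ ∣ p ∣ 2+∣q∣≤∣∁p∣ ⟩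
  ∣ p ∣ + ∣ ∁ p ∣        ≡⟨ cong (∣ p ∣ +_) (∣∁p∣≡n∸∣p∣ p) ⟩
  ∣ p ∣ + (n ∸ ∣ p ∣)    ≡⟨ m+[n∸m]≡n (∣p∣≤n p) ⟩
  n                      ∎
  where
  open ≤-Reasoning

  q⊆∁p-v-w : ∀ {x} → x ∈ q → x ∈ ∁ p - v - w
  q⊆∁p-v-w x∈q = x∈p∧x≢y⇒x∈p-y
    (x∈p∧x≢y⇒x∈p-y (x∉p⇒x∈∁p λ x∈p → disjoint x∈p x∈q) λ { refl → v∉q x∈q })
    λ { refl → w∉q x∈q }

  2+∣q∣≤∣∁p∣ : 2 + ∣ q ∣ ≤ ∣ ∁ p ∣
  2+∣q∣≤∣∁p∣ = begin
    2 + ∣ q ∣              ≤⟨ +-monoʳ-≤ 2 (p⊆q⇒∣p∣≤∣q∣ q⊆∁p-v-w) ⟩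
    2 + ∣ ∁ p - v - w ∣    ≤⟨ s≤s (x∈p⇒∣p-x∣<∣p∣
                                (x∈p∧x≢y⇒x∈p-y (x∉p⇒x∈∁p w∉p) (v≢w ∘ sym))) ⟩
    1 + ∣ ∁ p - v ∣        ≤⟨ x∈p⇒∣p-x∣<∣p∣ (x∉p⇒x∈∁p v∉p) ⟩
    ∣ ∁ p ∣                ∎

module _ (G : Graph n) where
  open Graph G

  ∈N⁺ : v ~ w → w ∈ N G v
  ∈N⁺ {v} {w} v~w = lookup⇒[]= w _
    (trans (lookup∘tabulate _ w) (dec-true (v ~? w) v~w))

  v∉N : ∀ v → v ∉ N G v
  v∉N v v∈N with v ~? v | trans (sym (lookup∘tabulate (λ u → does (v ~? u)) v)) ([]=⇒lookup v∈N)
  ... | yes v~v | _ = ~-irrefl refl v~v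

  v∈N[v] : ∀ v → v ∈ N[ G ] v
  v∈N[v] v = x∈p∪q⁺ (inj₁ (x∈⁅x⁆ v))

  ~⇒∈N[] : v ~ w → w ∈ N[ G ] v
  ~⇒∈N[] v~w = x∈p∪q⁺ (inj₂ (∈N⁺ v~w))

  ∉∁N[]∩ : w ∈ N[ G ] v → w ∉ ∁ (N[ G ] v) ∩ B
  ∉∁N[]∩ {v = v} {B} w∈N w∈∁N∩B = x∈∁p⇒x∉p (proj₁ (x∈p∩q⁻ (∁ (N[ G ] v)) B w∈∁N∩B)) w∈N

  degree<∣N[v]∣ : ∀ v → degree G v < ∣ N[ G ] v ∣
  degree<∣N[v]∣ v = p⊂q⇒∣p∣<∣q∣ (x∈p∪q⁺ ∘ inj₂ , v , v∈N[v] v , v∉N v)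

  ∣B∣≤k+∣∁N[v]∩B∣ : IsLimitedPacking k G B → ∀ v → ∣ B ∣ ≤ k + ∣ ∁ (N[ G ] v) ∩ B ∣
  ∣B∣≤k+∣∁N[v]∩B∣ {B = B} pB v = ≤-trans (≤-reflexive (∣p∣≡∣q∩p∣+∣∁q∩p∣ B (N[ G ] v)))
    (+-monoˡ-≤ _ (pB v))

  -- When the packing is all of V, the packing condition bounds every closed neighbourhood by `k`,
  -- and each of these exceeds the degree by the vertex itself. `1 ≤ k` handles the default value 0
  -- of the maximum in `Δ`.
  ⊤-packing⇒Δ<k : 1 ≤ k → IsLimitedPacking k G ⊤ → Δ G < k
  ⊤-packing⇒Δ<k {k} 1≤k p⊤ = max<v⁺ 1≤k (map⁺ (tabulate⁺ degree<k))
    where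
    degree<k : ∀ v → degree G v < k
    degree<k v = <-≤-trans (degree<∣N[v]∣ v)
      (subst (λ p → ∣ p ∣ ≤ k) (∩-identityʳ (N[ G ] v)) (p⊤ v))

  k≤Δ⇒packing-misses : 1 ≤ k → k ≤ Δ G → IsLimitedPacking k G B → ∃ (_∉ B)
  k≤Δ⇒packing-misses {k} {B} 1≤k k≤Δ pB = ¬∀⟶∃¬ n (_∈ B) (_∈? B) λ all∈B →
    <⇒≱ (⊤-packing⇒Δ<k 1≤k (subst (IsLimitedPacking k G) (⊆-antisym (⊆-max B) λ _ → all∈B _) pB)) k≤Δ

  L≤n : ∀ k → L k G ≤ n
  L≤n k with L-attained k G
  ... | B , _ , ∣B∣≡L = subst (_≤ n) ∣B∣≡L (∣p∣≤n B)

  L≡n⇒Δ<k : 1 ≤ k → L k G ≡ n → Δ G < k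
  L≡n⇒Δ<k {k} 1≤k L≡n with L-attained k G
  ... | B , pB , ∣B∣≡L =
    ⊤-packing⇒Δ<k 1≤k (subst (IsLimitedPacking k G) (∣p∣≡n⇒p≡⊤ (trans ∣B∣≡L L≡n)) pB)

∉N[]⇒∈N[complement] : ∀ (G : Graph n) → w ∉ N[ G ] v → w ∈ N[ complement G ] v
∉N[]⇒∈N[complement] {w = w} {v} G w∉N = ~⇒∈N[] (complement G)
  ((λ { refl → w∉N (v∈N[v] G v) }) , w∉N ∘ ~⇒∈N[] G)

module _ (G : Graph n) (pB : IsLimitedPacking k G B) (pC : IsLimitedPacking k (complement G) C) where
  open Graph G

  private
    Ḡ : Graph n
    Ḡ = complement G

  -- Each packing has at most `k` vertices in the closed neighbourhood of `v`. The remainders `P`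
  -- and `Q` are disjoint and both avoid `v`, which is in both neighbourhoods; avoiding `w` too
  -- leaves them at most n - 2 vertices together.
  packings-bound-at : v ≢ w → w ∉ ∁ (N[ G ] v) ∩ B → w ∉ ∁ (N[ Ḡ ] v) ∩ C →
    ∣ B ∣ + ∣ C ∣ ≤ n + 2 * k ∸ 2
  packings-bound-at {v} {w} v≢w w∉P w∉Q = m+n≤o⇒m≤o∸n (∣ B ∣ + ∣ C ∣) (begin
    ∣ B ∣ + ∣ C ∣ + 2                ≤⟨ +-monoˡ-≤ 2 (+-mono-≤ (∣B∣≤k+∣∁N[v]∩B∣ G pB v)
                                                             (∣B∣≤k+∣∁N[v]∩B∣ Ḡ pC v)) ⟩
    (k + ∣ P ∣) + (k + ∣ Q ∣) + 2    ≡⟨ rearrange k ∣ P ∣ ∣ Q ∣ ⟩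
    ∣ P ∣ + ∣ Q ∣ + 2 + 2 * k        ≤⟨ +-monoˡ-≤ (2 * k) (disjoint-missing-two P∩Q≡∅ v≢w
                                         (∉∁N[]∩ G (v∈N[v] G v)) (∉∁N[]∩ Ḡ (v∈N[v] Ḡ v)) w∉P w∉Q) ⟩
    n + 2 * k                        ∎)
    where
    open ≤-Reasoning

    P Q : Subset n
    P = ∁ (N[ G ] v) ∩ B
    Q = ∁ (N[ Ḡ ] v) ∩ C

    P∩Q≡∅ : ∀ {x} → x ∈ P → x ∉ Q
    P∩Q≡∅ x∈P = ∉∁N[]∩ Ḡ (∉N[]⇒∈N[complement] G (x∈∁p⇒x∉p (proj₁ (x∈p∩q⁻ (∁ (N[ G ] v)) B x∈P))))

    rearrange : ∀ k a b → (k + a) + (k + b) + 2 ≡ a + b + 2 + 2 * k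
    rearrange = solve-∀

  -- Here `w` escapes `P` by lying outside `B`, and escapes `Q` by being a neighbour of `v` in the
  -- complement. `bound-adjacent` is the dual case.
  bound-nonadjacent : v ≢ w → ¬ v ~ w → w ∉ B → ∣ B ∣ + ∣ C ∣ ≤ n + 2 * k ∸ 2
  bound-nonadjacent {v} v≢w v≁w w∉B = packings-bound-at v≢w
    (w∉B ∘ proj₂ ∘ x∈p∩q⁻ (∁ (N[ G ] v)) B) (∉∁N[]∩ Ḡ (~⇒∈N[] Ḡ (v≢w , v≁w)))

  bound-adjacent : v ~ w → w ∉ C → ∣ B ∣ + ∣ C ∣ ≤ n + 2 * k ∸ 2
  bound-adjacent {v} v~w w∉C = packings-bound-at (λ v≡w → ~-irrefl v≡w v~w)
    (∉∁N[]∩ G (~⇒∈N[] G v~w)) (w∉C ∘ proj₂ ∘ x∈p∩q⁻ (∁ (N[ Ḡ ] v)) C)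

  bound-missing : u ∉ B → w ∉ C → ∃ (_≢ u) → ∣ B ∣ + ∣ C ∣ ≤ n + 2 * k ∸ 2
  bound-missing {u} {w} u∉B w∉C _ with u ≟ᶠ w
  ... | no u≢w with u ~? w
  ...   | yes u~w = bound-adjacent u~w w∉C
  -- The centre is now `w`, and the second missed vertex is `u`.
  ...   | no  u≁w = bound-nonadjacent (u≢w ∘ sym) (u≁w ∘ ~-sym) u∉B
  -- A single vertex `u` is missing from both packings, so any other vertex `x` can be the centre,
  -- whether or not it is adjacent to `u`.
  bound-missing {u} u∉B w∉C (x , x≢u) | yes refl with x ~? u
  ...   | yes x~u = bound-adjacent x~u w∉C
  ...   | no  x≁u = bound-nonadjacent x≢u x≁u u∉B

another-vertex : 2 ≤ n → (u : Fin n) → ∃ (_≢ u)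
another-vertex (s≤s (s≤s z≤n)) zero    = suc zero , λ ()
another-vertex (s≤s (s≤s z≤n)) (suc u) = zero , λ ()

small-bound : ∀ (G : Graph n) → 1 ≤ k → 2 ≤ n → SmallLimit k G →
  L k G + L k (complement G) ≤ n + 2 * k ∸ 2
small-bound {n} {k} G 1≤k 2≤n small
  with L-attained k G | L-attained k (complement G)
... | B , pB , ∣B∣≡L | C , pC , ∣C∣≡L
  with k≤Δ⇒packing-misses G 1≤k (m≤n⊓o⇒m≤n _ _ small) pB
     | k≤Δ⇒packing-misses (complement G) 1≤k (m≤n⊓o⇒m≤o _ _ small) pC
... | u , u∉B | w , w∉C = subst (_≤ n + 2 * k ∸ 2) (cong₂ _+_ ∣B∣≡L ∣C∣≡L)
  (bound-missing G pB pC u∉B w∉C (another-vertex 2≤n u))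

large-bound : ∀ k (G : Graph n) → L k G + L k (complement G) ≤ 2 * n
large-bound {n} k G = subst (L k G + L k (complement G) ≤_) (cong (n +_) (sym (+-identityʳ n)))
  (+-mono-≤ (L≤n G k) (L≤n (complement G) k))

-- A sum of 2n would force both packing numbers to equal n, hence `k` to exceed both maximum
-- degrees, which is the large case.
not-large-bound : ∀ (G : Graph n) → 1 ≤ k → ¬ LargeLimit k G →
  L k G + L k (complement G) ≤ 2 * n ∸ 1
not-large-bound {n} {k} G 1≤k ¬large = <⇒≤pred (≤∧≢⇒< (large-bound k G) λ L+L̄≡2n →
  ¬large (subst (_≤ k) (+-comm 1 _) (⊔-lub
    (L≡n⇒Δ<k G 1≤k (tight (L≤n G k) (L≤n Ḡ k) L+L̄≡2n))
    (L≡n⇒Δ<k Ḡ 1≤k (tight (L≤n Ḡ k) (L≤n G k) (trans (+-comm (L k Ḡ) (L k G)) L+L̄≡2n))))))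
  where
  Ḡ : Graph n
  Ḡ = complement G

  tight : ∀ {a b} → a ≤ n → b ≤ n → a + b ≡ 2 * n → a ≡ n
  tight a≤n b≤n a+b≡2n = ≤∧≮⇒≡ a≤n λ a<n →
    <⇒≢ (+-mono-<-≤ a<n b≤n) (trans a+b≡2n (cong (n +_) (+-identityʳ n)))

-- The complete bipartite graph with the even and the odd vertices as parts:
-- K₂ for n = 2 and the path P₃ for n = 3.
parityGraph : ∀ n → Graph n
parityGraph n = record
  { _~_      = λ u v → toℕ u % 2 ≢ toℕ v % 2
  ; _~?_     = λ u v → ¬? (toℕ u % 2 ≟ toℕ v % 2)
  ; ~-sym    = λ u~v → u~v ∘ sym
  ; ~-irrefl = λ { refl u~u → u~u refl }
  }

theorem3p13 : (∀ (k n : ℕ) (G : Graph n) → 1 ≤ k → 2 ≤ n →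
    (LargeLimit k G → L k G + L k (complement G) ≤ 2 * n) ×
    (SmallLimit k G → L k G + L k (complement G) ≤ (n + 2 * k) ∸ 2) ×
    (MiddleLimit k G → L k G + L k (complement G) ≤ 2 * n ∸ 1)) ×
    (∃[ k ] ∃[ n ] Σ[ G ∈ Graph n ] (1 ≤ k × 2 ≤ n × LargeLimit k G ×
    L k G + L k (complement G) ≡ 2 * n)) ×
    (∃[ k ] ∃[ n ] Σ[ G ∈ Graph n ] (1 ≤ k × 2 ≤ n × SmallLimit k G ×
    L k G + L k (complement G) ≡ (n + 2 * k) ∸ 2)) ×
    (∃[ k ] ∃[ n ] Σ[ G ∈ Graph n ] (1 ≤ k × 2 ≤ n × MiddleLimit k G ×
    L k G + L k (complement G) ≡ 2 * n ∸ 1))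
theorem3p13 =
  (λ k n G 1≤k 2≤n →
    (λ _ → large-bound k G) ,
    small-bound G 1≤k 2≤n ,
    (λ (¬large , _) → not-large-bound G 1≤k ¬large)) ,
  -- K₂ with `k` = 2: both packing numbers are 2. Then P₃ with `k` = 1: the middle vertex dominates
  -- P₃, giving 1, and the complement, an edge plus an isolated vertex, gives 2. Last, K₂ with `k` =
  -- 1 gives 1 + 2. All these values are found by computation.
  (2 , 2 , parityGraph 2 , s≤s z≤n , ≤-refl , ≤-refl , refl) ,
  (1 , 3 , parityGraph 3 , ≤-refl , s≤s (s≤s z≤n) , ≤-refl , refl) ,
  (1 , 2 , parityGraph 2 , ≤-refl , ≤-refl , ((λ { (s≤s ()) }) , λ ()) , refl)
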